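{- Fix positive integers $N$ and $t$, and a graph $H$ with $n$ vertices; write $K=K_t$. The minimum number of subgraphs isomorphic to $K_t$ among all $H$-covered graphs with $N$ vertices, denoted $\operatorname{cov}_{K_t}(N,H)$, is equal to the optimal value of the integer program $$\text{minimize } \sum_{k=1}^n a_K^H(k)\,x_k \quad\text{subject to}\quad \sum_{k=1}^n k x_k=N,\quad x_k\in\mathbb{Z}\ (1\le k\le n),\quad x_k\ge 0\ (1\le k\le n-1),\quad x_n\ge 1.$$ (If $N<n$, there are no $N$-vertex $H$-covered graphs and the program is infeasible; both minima are then taken to be $+\infty$.)
   Context: All graphs are finite and simple. A graph $G$ is $H$-covered if every vertex of $G$ lies in a (not necessarily induced) subgraph of $G$ isomorphic to $H$. For graphs $H,T$ and $A\subseteq V(H)$, $a_T^H(A)$ denotes the number of subgraphs of $H$ isomorphic to $T$ which have at least one vertex in $A$; $a_T^H(k)$ denotes the minimum of $a_T^H(A)$ over all $k$-vertex subsets $A\subseteq V(H)$. -}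

module Defs where

open import Data.Bool.Base using (Bool; true; false; not)
import Data.Bool.Properties as Bool
open import Data.Fin.Base using (Fin; toℕ)
open import Data.Fin.Properties using (_≟_; any?; all?)
open import Data.Fin.Subset using (Subset; inside; outside; _∈_; _∩_; ∣_∣; Nonempty)
open import Data.Fin.Subset.Properties using (_∈?_; nonempty?)
open import Data.Integer.Base as ℤ using (ℤ; +_; 0ℤ; 1ℤ)
import Data.Integer.Properties as ℤ
open import Data.List.Base as List using (List; []; _∷_; cartesianProductWith; filter; length)
open import Data.List.Extrema.Nat using (min)
open import Data.Nat.Base as ℕ using (ℕ; zero; suc; _<_; _<ᵇ_)
import Data.Nat.Properties as ℕ
open import Data.Product.Base using (∃; ∃-syntax; _×_; _,_)
open import Data.Vec.Base as Vec using (Vec; lookup; tabulate)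
open import Function.Definitions using (Injective)
open import Relation.Binary.PropositionalEquality using (_≡_; refl; sym; cong)
open import Relation.Nullary using (Dec; yes; no; ¬_; contradiction)
open import Relation.Nullary.Construct.Add.Supremum using (_⁺; [_]; ⊤⁺)
open import Relation.Nullary.Decidable using (does; map′; _×-dec_; _→-dec_)
open import Relation.Unary using (Decidable)
open import Algebra.Properties.Monoid.Sum ℤ.+-0-monoid using (sum)

-- Finite simple graphs on the vertex set Fin n.

record Graph (n : ℕ) : Set where
  field
    adj         : Fin n → Fin n → Bool
    symmetric   : ∀ u v → adj u v ≡ adj v u
    irreflexive : ∀ v → adj v v ≡ false

open Graph public

K : ∀ t → Graph t
K t = record { adj = distinct ; symmetric = distinct-sym ; irreflexive = distinct-irrefl }
  where
  distinct : Fin t → Fin t → Bool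
  distinct i j = not (does (i ≟ j))

  distinct-sym : ∀ i j → distinct i j ≡ distinct j i
  distinct-sym i j with i ≟ j | j ≟ i
  ... | yes _   | yes _   = refl
  ... | no  _   | no  _   = refl
  ... | yes i≡j | no  j≢i = contradiction (sym i≡j) j≢i
  ... | no  i≢j | yes j≡i = contradiction (sym j≡i) i≢j

  distinct-irrefl : ∀ i → distinct i i ≡ false
  distinct-irrefl i with i ≟ i
  ... | yes _   = refl
  ... | no  i≢i = contradiction refl i≢i

-- A candidate subgraph: a vertex set together with an adjacency matrix, given
-- by its rows.  Subgraphs are first-order data, and by IsSubgraph the matrix is
-- symmetric, so that each (vertex set, edge set) pair is represented by exactly
-- one value and counting values counts subgraphs.

record Sub (n : ℕ) : Set where
  constructor sub
  field
    vertices : Subset n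
    rows     : Vec (Subset n) n

open Sub public

edge : ∀ {n} → Sub n → Fin n → Fin n → Bool
edge S u v = lookup (lookup (rows S) u) v

-- Not necessarily induced.  By symmetry it is enough to require that the first
-- endpoint of every edge of S is a vertex of S.

IsSubgraph : ∀ {n} → Graph n → Sub n → Set
IsSubgraph G S =
    (∀ u v → edge S u v ≡ edge S v u)
  × (∀ u v → edge S u v ≡ true → u ∈ vertices S × adj G u v ≡ true)

-- S is isomorphic to T: the vector φ lists the images of the vertices of T
-- under an isomorphism onto S.

IsIsomorphic : ∀ {t n} → Graph t → Sub n → Set
IsIsomorphic {t} {n} T S = ∃[ φ ] IsIso φ
  module Isomorphic where
  IsIso : Vec (Fin n) t → Set
  IsIso φ =
      Injective _≡_ _≡_ (lookup φ)
    × (∀ i → lookup φ i ∈ vertices S)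
    × (∀ v → v ∈ vertices S → ∃[ i ] lookup φ i ≡ v)
    × (∀ i j → edge S (lookup φ i) (lookup φ j) ≡ adj T i j)

IsCopy : ∀ {t n} → Graph t → Graph n → Sub n → Set
IsCopy T G S = IsSubgraph G S × IsIsomorphic T S

Covered : ∀ {n N} → Graph n → Graph N → Set
Covered H G = ∀ v → ∃[ S ] (IsCopy H G S × v ∈ vertices S)

isSubgraph? : ∀ {n} (G : Graph n) → Decidable (IsSubgraph G)
isSubgraph? G S =
        all? (λ u → all? λ v → edge S u v Bool.≟ edge S v u)
  ×-dec all? (λ u → all? λ v → (edge S u v Bool.≟ true)
          →-dec ((u ∈? vertices S) ×-dec (adj G u v Bool.≟ true)))

anyVec? : ∀ {n} t {P : Vec (Fin n) t → Set} → Decidable P → Dec (∃ P)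
anyVec? zero    P? = map′ (λ p → Vec.[] , p) (λ { (Vec.[] , p) → p }) (P? Vec.[])
anyVec? (suc t) P? =
  map′ (λ { (i , φ , p) → i Vec.∷ φ , p }) (λ { (i Vec.∷ φ , p) → i , φ , p })
       (any? λ i → anyVec? t λ φ → P? (i Vec.∷ φ))

isIsomorphic? : ∀ {t n} (T : Graph t) → Decidable (IsIsomorphic {t} {n} T)
isIsomorphic? {t} {n} T S = anyVec? t isIso?
  where
  isIso? : Decidable (Isomorphic.IsIso T S)
  isIso? φ =
          map′ (λ inj {i} {j} → inj i j) (λ inj i j → inj {i} {j})
            (all? λ i → all? λ j → (lookup φ i ≟ lookup φ j) →-dec (i ≟ j))
    ×-dec all? (λ i → lookup φ i ∈? vertices S)
    ×-dec all? (λ v → (v ∈? vertices S) →-dec any? (λ i → lookup φ i ≟ v))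
    ×-dec all? (λ i → all? λ j → edge S (lookup φ i) (lookup φ j) Bool.≟ adj T i j)

isCopy? : ∀ {t n} (T : Graph t) (G : Graph n) → Decidable (IsCopy T G)
isCopy? T G S = isSubgraph? G S ×-dec isIsomorphic? T S

-- Every vector with entries from a repetition-free list, each exactly once.

vectors : ∀ {A : Set} → List A → ∀ n → List (Vec A n)
vectors xs zero    = Vec.[] ∷ []
vectors xs (suc n) = cartesianProductWith Vec._∷_ xs (vectors xs n)

subsets : ∀ n → List (Subset n)
subsets = vectors (outside ∷ inside ∷ [])

candidates : ∀ n → List (Sub n)
candidates n = cartesianProductWith sub (subsets n) (vectors (subsets n) n)

copies : ∀ {t n} → Graph t → Graph n → List (Sub n)
copies {n = n} T G = filter (isCopy? T G) (candidates n)

#copies : ∀ {t n} → Graph t → Graph n → ℕ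
#copies T G = length (copies T G)

-- a_T^H(A)

#copiesMeeting : ∀ {t n} → Graph t → Graph n → Subset n → ℕ
#copiesMeeting T H A = length (filter (λ S → nonempty? (A ∩ vertices S)) (copies T H))

-- a_T^H(k), for k ≤ n.  The library's min takes a starting value in addition to
-- the list; the one supplied is the value at the k-vertex subset {0, …, k-1},
-- so it is itself one of the values being minimized.

minCopiesMeeting : ∀ {t n} → Graph t → Graph n → ℕ → ℕ
minCopiesMeeting {n = n} T H k =
  min (#copiesMeeting T H (tabulate λ i → toℕ i <ᵇ k))
      (List.map (#copiesMeeting T H) (filter (λ A → ∣ A ∣ ℕ.≟ k) (subsets n)))

-- The minimum of a set of integers, with ⊤⁺ = +∞ for the empty set.

IsMinimum : (ℤ → Set) → ℤ ⁺ → Set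
IsMinimum P [ m ] = P m × (∀ v → P v → m ℤ.≤ v)
IsMinimum P ⊤⁺    = ∀ v → ¬ P v

-- cov_T(N, H) = m

IsCov : ∀ {t n} → Graph t → ℕ → Graph n → ℤ ⁺ → Set
IsCov T N H = IsMinimum λ v → ∃[ G ] (Covered {N = N} H G × + #copies T G ≡ v)

-- The unknown x_k of the integer program is x i, where k = index i = toℕ i + 1.

index : ∀ {n} → Fin n → ℕ
index i = suc (toℕ i)

Feasible : ∀ {n} → ℕ → (Fin n → ℤ) → Set
Feasible {n} N x =
    sum (λ i → + index i ℤ.* x i) ≡ + N
  × (∀ i → index i < n → 0ℤ ℤ.≤ x i)
  × (∀ i → index i ≡ n → 1ℤ ℤ.≤ x i)

objective : ∀ {t n} → Graph t → Graph n → (Fin n → ℤ) → ℤ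
objective T H x = sum (λ i → + minCopiesMeeting T H (index i) ℤ.* x i)

IsOptimalValue : ∀ {t n} → Graph t → ℕ → Graph n → ℤ ⁺ → Set
IsOptimalValue T N H = IsMinimum λ v → ∃[ x ] (Feasible N x × objective T H x ≡ v)

{-# OPTIONS --safe #-}

-- Both minima are approached through multisets of sizes k, one of which is n.
--
-- Cheap covered graphs: start with a copy of H and, for every further size k,
-- choose k vertices A of H meeting as few copies of K_t as possible and glue in
-- a copy of H that shares with the first one exactly the vertices outside A.
-- New vertices of different copies are not adjacent, so a clique with a new
-- vertex lies in a single copy of H and meets its A; thus each step creates at
-- most a(k) cliques.
--
-- Lower bound: cover G greedily by copies of H, each containing a vertex not yet
-- covered.  If a copy covers k new vertices, at least a(k) of its subgraphs K_t
-- contain a newly covered vertex, and these are not counted at any other step.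

module Submission where

open import Defs
open import Data.Bool.Base using (Bool; true; false; not)
import Data.Bool.Properties as Bool
open import Data.Fin.Base using (Fin; zero; suc; toℕ; fromℕ; fromℕ<; splitAt; join; _↑ʳ_)
open import Data.Fin.Properties
  using (_≟_; any?; injective⇒≤; suc-injective; toℕ<n; toℕ-injective; toℕ-fromℕ; toℕ-fromℕ<;
         splitAt-join; join-splitAt; ↑ʳ-injective)
open import Data.Fin.Subset using (Subset; inside; outside; _∈_; _∩_; ∣_∣; ⊤)
open import Data.Fin.Subset.Properties
  using (_∈?_; nonempty?; ∈⊤; ∣⊤∣≡n; ∣p∣≡n⇒p≡⊤; ∣p∣≤n; x∈p∩q⁺; x∈p∩q⁻)
open import Data.Integer.Base as ℤ using (ℤ; +_; 0ℤ; 1ℤ; -1ℤ)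
import Data.Integer.Properties as ℤ
open import Data.List.Base as List using (List; []; _∷_; _++_; length; filter; foldr; replicate; allFin)
import Data.List.Membership.DecPropositional as DecMembership
open import Data.List.Membership.Propositional using () renaming (_∈_ to _∈ˡ_; _∉_ to _∉ˡ_)
open import Data.List.Membership.Propositional.Properties
  using (∈-map⁺; ∈-map⁻; ∈-++⁺ˡ; ∈-++⁺ʳ; ∈-filter⁺; ∈-filter⁻; ∈-lookup; ∈-allFin;
         ∈-cartesianProductWith⁺)
open import Data.List.Properties using (length-map; length-++; length-filter; length-tabulate; filter-all)
open import Data.List.Relation.Unary.All as All using (All; []; _∷_)
import Data.List.Relation.Unary.All.Properties as All
open import Data.List.Relation.Unary.AllPairs using ([]; _∷_)
open import Data.List.Relation.Unary.Any using (here; there) renaming (index to position)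
open import Data.List.Relation.Unary.Any.Properties using (lookup-index)
open import Data.List.Relation.Unary.Unique.Propositional using (Unique)
import Data.List.Relation.Unary.Unique.Propositional.Properties as Unique
open import Data.Nat.Base as ℕ using (ℕ; zero; suc; _+_; _*_; _≤_; _<_; _<ᵇ_; z≤n; s≤s; NonZero)
open import Data.Nat.Induction using (<-rec)
import Data.Nat.Properties as ℕ
open import Data.List.Extrema ℕ.≤-totalOrder using (min≤xs; argmin-sel)
open import Data.Product.Base using (∃; ∃-syntax; _×_; _,_; proj₁; proj₂)
open import Data.Sum.Base using (_⊎_; inj₁; inj₂)
open import Data.Sum.Properties using (inj₁-injective; inj₂-injective)
open import Data.Vec.Base as Vec using (Vec; lookup; tabulate)
open import Data.Vec.Functional using (updateAt)
open import Data.Vec.Functional.Properties using (updateAt-updates; updateAt-minimal)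
open import Data.Vec.Properties
  using (lookup∘tabulate; tabulate∘lookup; tabulate-cong; []=⇒lookup; lookup⇒[]=; ∷-injective; lookup-map;
         toList∘fromList)
open import Function.Base using (id; _∘_)
open import Function.Bundles using (mk⇔)
open import Function.Definitions using (Injective)
open import Relation.Binary.PropositionalEquality
open import Relation.Nullary using (Dec; yes; no; ¬_; contradiction)
open import Relation.Nullary.Construct.Add.Supremum using ([_]; ⊤⁺)
open import Relation.Nullary.Decidable using (does; map′; dec-true; dec-false; ¬?; _×-dec_)
open import Relation.Unary using (Decidable)
open import Algebra.Properties.CommutativeSemigroup ℤ.+-commutativeSemigroup using (x∙yz≈y∙xz)
open import Algebra.Properties.Monoid.Sum ℤ.+-0-monoid using (sum)

private variable
  A : Set
  n t M N c : ℕ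

-- Repetition-free lists and the enumeration of copies.

Unique⇒lookup-injective : {xs : List A} → Unique xs → Injective _≡_ _≡_ (List.lookup xs)
Unique⇒lookup-injective (x∉ ∷ xs!) {zero}  {zero}  eq = refl
Unique⇒lookup-injective (x∉ ∷ xs!) {zero}  {suc j} eq = contradiction eq (All.lookup x∉ (∈-lookup j))
Unique⇒lookup-injective (x∉ ∷ xs!) {suc i} {zero}  eq = contradiction (sym eq) (All.lookup x∉ (∈-lookup i))
Unique⇒lookup-injective (x∉ ∷ xs!) {suc i} {suc j} eq = cong suc (Unique⇒lookup-injective xs! eq)

-- Sending each position of `xs` to a position of the same entry in `ys` is injective, because `xs`
-- has no repetitions. Both bounds count copies through this comparison.
Unique-⊆⇒length≤ : {xs ys : List A} → Unique xs → (∀ {x} → x ∈ˡ xs → x ∈ˡ ys) → length xs ≤ length ys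
Unique-⊆⇒length≤ {xs = xs} {ys} xs! xs⊆ys = injective⇒≤ {f = place} place-injective
  where
  place : Fin (length xs) → Fin (length ys)
  place i = position (xs⊆ys (∈-lookup i))

  lookup-place : ∀ i → List.lookup ys (place i) ≡ List.lookup xs i
  lookup-place i = sym (lookup-index (xs⊆ys (∈-lookup i)))

  place-injective : Injective _≡_ _≡_ place
  place-injective {i} {j} eq = Unique⇒lookup-injective xs!
    (trans (sym (lookup-place i)) (trans (cong (List.lookup ys) eq) (lookup-place j)))

vectors-complete : {xs : List A} → (∀ x → x ∈ˡ xs) → ∀ (v : Vec A n) → v ∈ˡ vectors xs n
vectors-complete all∈ Vec.[]      = here refl
vectors-complete all∈ (x Vec.∷ v) = ∈-cartesianProductWith⁺ Vec._∷_ (all∈ x) (vectors-complete all∈ v)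

vectors-unique : {xs : List A} → Unique xs → ∀ n → Unique (vectors xs n)
vectors-unique xs! zero    = [] ∷ []
vectors-unique xs! (suc n) = Unique.cartesianProductWith⁺ Vec._∷_ ∷-injective xs! (vectors-unique xs! n)

subsets-complete : ∀ (p : Subset n) → p ∈ˡ subsets n
subsets-complete = vectors-complete λ { false → here refl ; true → there (here refl) }

subsets-unique : ∀ n → Unique (subsets n)
subsets-unique = vectors-unique (((λ ()) ∷ []) ∷ [] ∷ [])

∈-copies⁺ : (T : Graph t) (G : Graph n) {S : Sub n} → IsCopy T G S → S ∈ˡ copies T G
∈-copies⁺ T G {S} = ∈-filter⁺ (isCopy? T G)
  (∈-cartesianProductWith⁺ sub (subsets-complete (vertices S)) (vectors-complete subsets-complete (rows S)))

∈-copies⁻ : (T : Graph t) (G : Graph n) {S : Sub n} → S ∈ˡ copies T G → IsCopy T G S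
∈-copies⁻ {n = n} T G = proj₂ ∘ ∈-filter⁻ (isCopy? T G) {xs = candidates n}

copies-unique : (T : Graph t) (G : Graph n) → Unique (copies T G)
copies-unique {n = n} T G = Unique.filter⁺ (isCopy? T G)
  (Unique.cartesianProductWith⁺ sub (λ { refl → refl , refl })
    (subsets-unique n) (vectors-unique (subsets-unique n) n))

-- Elements of a subset and the minima a(k).

elements : Subset n → List (Fin n)
elements Vec.[]            = []
elements (outside Vec.∷ p) = List.map suc (elements p)
elements (inside  Vec.∷ p) = zero ∷ List.map suc (elements p)

length-elements : (p : Subset n) → length (elements p) ≡ ∣ p ∣
length-elements Vec.[]            = refl
length-elements (outside Vec.∷ p) = trans (length-map suc (elements p)) (length-elements p)
length-elements (inside  Vec.∷ p) = cong suc (trans (length-map suc (elements p)) (length-elements p))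

∈-elements⁺ : {p : Subset n} {i : Fin n} → i ∈ p → i ∈ˡ elements p
∈-elements⁺ Vec.here                            = here refl
∈-elements⁺ {p = outside Vec.∷ _} (Vec.there i∈p) = ∈-map⁺ suc (∈-elements⁺ i∈p)
∈-elements⁺ {p = inside  Vec.∷ _} (Vec.there i∈p) = there (∈-map⁺ suc (∈-elements⁺ i∈p))

∈-elements⁻ : (p : Subset n) {i : Fin n} → i ∈ˡ elements p → i ∈ p
∈-elements⁻ (outside Vec.∷ p) i∈ with _ , j∈ , refl ← ∈-map⁻ suc i∈ = Vec.there (∈-elements⁻ p j∈)
∈-elements⁻ (inside  Vec.∷ p) (here refl) = Vec.here
∈-elements⁻ (inside  Vec.∷ p) (there i∈) with _ , j∈ , refl ← ∈-map⁻ suc i∈ = Vec.there (∈-elements⁻ p j∈)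

elements-unique : (p : Subset n) → Unique (elements p)
elements-unique Vec.[]            = []
elements-unique (outside Vec.∷ p) = Unique.map⁺ suc-injective (elements-unique p)
elements-unique (inside  Vec.∷ p) =
  All.map⁺ (All.tabulate λ _ ()) ∷ Unique.map⁺ suc-injective (elements-unique p)

-- Ensures that the starting value of the minimum in `minCopiesMeeting` also comes from a subset of
-- size `k`, so that the minimum is attained at such a subset in either case.
∣initial∣ : ∀ {k n} → k ≤ n → ∣ tabulate {n = n} (λ i → toℕ i <ᵇ k) ∣ ≡ k
∣initial∣ {k} {zero} z≤n = refl
∣initial∣ {zero} {suc n} z≤n = ∣initial∣ {zero} {n} z≤n
∣initial∣ {suc k} {suc n} (s≤s k≤n) = cong suc (∣initial∣ k≤n)

minCopiesMeeting≤ : (T : Graph t) (H : Graph n) (p : Subset n) →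
  minCopiesMeeting T H ∣ p ∣ ≤ #copiesMeeting T H p
minCopiesMeeting≤ {n = n} T H p = All.lookup (min≤xs _ _)
  (∈-map⁺ (#copiesMeeting T H) (∈-filter⁺ (λ q → ∣ q ∣ ℕ.≟ ∣ p ∣) (subsets-complete p) refl))

minCopiesMeeting-attained : (T : Graph t) (H : Graph n) → ∀ {k} → k ≤ n →
  ∃[ p ] (∣ p ∣ ≡ k × #copiesMeeting T H p ≡ minCopiesMeeting T H k)
minCopiesMeeting-attained {n = n} T H {k} k≤n with
  argmin-sel id (#copiesMeeting T H (tabulate λ i → toℕ i <ᵇ k))
    (List.map (#copiesMeeting T H) (filter (λ p → ∣ p ∣ ℕ.≟ k) (subsets n)))
... | inj₁ eq = _ , ∣initial∣ k≤n , sym eq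
... | inj₂ min∈ with p , p∈ , eq ← ∈-map⁻ (#copiesMeeting T H) min∈ =
  p , proj₂ (∈-filter⁻ (λ p → ∣ p ∣ ℕ.≟ k) {xs = subsets n} p∈) , sym eq

-- Moving subgraphs along maps of vertices.

lookup-ext : {v w : Vec A n} → (∀ i → lookup v i ≡ lookup w i) → v ≡ w
lookup-ext {v = v} {w} eq = trans (sym (tabulate∘lookup v)) (trans (tabulate-cong eq) (tabulate∘lookup w))

Sub-ext : {S S′ : Sub n} → (∀ v → lookup (vertices S) v ≡ lookup (vertices S′) v) →
  (∀ u v → edge S u v ≡ edge S′ u v) → S ≡ S′
Sub-ext vs es = cong₂ sub (lookup-ext vs) (lookup-ext λ u → lookup-ext (es u))

fromMatrix : (Fin n → Bool) → (Fin n → Fin n → Bool) → Sub n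
fromMatrix V E = sub (tabulate V) (tabulate λ u → tabulate (E u))

edge-fromMatrix : (V : Fin n → Bool) (E : Fin n → Fin n → Bool) → ∀ u v → edge (fromMatrix V E) u v ≡ E u v
edge-fromMatrix V E u v = trans (cong (λ r → lookup r v) (lookup∘tabulate _ u)) (lookup∘tabulate (E u) v)

module _ (f : Fin n → Fin N) where

  pull : Sub N → Sub n
  pull S = fromMatrix (λ i → lookup (vertices S) (f i)) (λ i j → edge S (f i) (f j))

  vertex-pull : ∀ S i → lookup (vertices (pull S)) i ≡ lookup (vertices S) (f i)
  vertex-pull S = lookup∘tabulate (λ i → lookup (vertices S) (f i))

  edge-pull : ∀ S i j → edge (pull S) i j ≡ edge S (f i) (f j)
  edge-pull S = edge-fromMatrix (λ i → lookup (vertices S) (f i)) (λ i j → edge S (f i) (f j))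

  ∈-pull⁺ : ∀ S {i} → f i ∈ vertices S → i ∈ vertices (pull S)
  ∈-pull⁺ S {i} fi∈ = lookup⇒[]= i (vertices (pull S)) (trans (vertex-pull S i) ([]=⇒lookup fi∈))

  ∈-pull⁻ : ∀ S {i} → i ∈ vertices (pull S) → f i ∈ vertices S
  ∈-pull⁻ S {i} i∈ = lookup⇒[]= (f i) (vertices S) (trans (sym (vertex-pull S i)) ([]=⇒lookup i∈))

Fiber : (Fin n → Fin N) → Fin N → Set
Fiber f v = ∃[ i ] f i ≡ v

fiber? : (f : Fin n → Fin N) (v : Fin N) → Dec (Fiber f v)
fiber? f v = any? λ i → f i ≟ v

module _ {f : Fin n → Fin N} where

  -- The value at `v` of the extension of a Boolean function by `false` outside the image of `f`.
  -- Passing the decision as an argument lets the lemmas below split on it.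
  extend : ∀ {v} → Dec (Fiber f v) → (Fin n → Bool) → Bool
  extend (yes (i , _)) b = b i
  extend (no _)        b = false

  extend-image : Injective _≡_ _≡_ f → ∀ {i} (d : Dec (Fiber f (f i))) b → extend d b ≡ b i
  extend-image inj (yes (j , fj≡fi)) b = cong b (inj fj≡fi)
  extend-image inj (no ∉)            b = contradiction (_ , refl) ∉

  extend-true : ∀ {v} (d : Dec (Fiber f v)) {b} → extend d b ≡ true → ∃[ i ] (f i ≡ v × b i ≡ true)
  extend-true (yes (i , eq)) bi = i , eq , bi

  -- Outside the image the last hypothesis excludes `c = true`, so `c` agrees with the default
  -- `false`.
  extend-unique : ∀ {v} (d : Dec (Fiber f v)) {b c} → (∀ i → f i ≡ v → b i ≡ c) →
    (c ≡ true → Fiber f v) → extend d b ≡ c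
  extend-unique (yes (i , eq)) b≡c c⇒ = b≡c i eq
  extend-unique (no ∉) {c = false} b≡c c⇒ = refl
  extend-unique (no ∉) {c = true}  b≡c c⇒ = contradiction (c⇒ refl) ∉

module _ (f : Fin n → Fin N) where

  private
    pushVertex : Sub n → Fin N → Bool
    pushVertex S v = extend (fiber? f v) (lookup (vertices S))

    pushEdge : Sub n → Fin N → Fin N → Bool
    pushEdge S u v = extend (fiber? f u) λ i → extend (fiber? f v) (edge S i)

  push : Sub n → Sub N
  push S = fromMatrix (pushVertex S) (pushEdge S)

  private
    vertex-push : ∀ S v → lookup (vertices (push S)) v ≡ pushVertex S v
    vertex-push S = lookup∘tabulate (pushVertex S)

    edge-push : ∀ S u v → edge (push S) u v ≡ pushEdge S u v
    edge-push S = edge-fromMatrix (pushVertex S) (pushEdge S)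

  ∈-push⁻ : ∀ S {v} → v ∈ vertices (push S) → ∃[ i ] (f i ≡ v × i ∈ vertices S)
  ∈-push⁻ S {v} v∈
    with i , eq , i∈ ← extend-true (fiber? f v) (trans (sym (vertex-push S v)) ([]=⇒lookup v∈)) =
    i , eq , lookup⇒[]= i (vertices S) i∈

  edge-push⁻ : ∀ S u v → edge (push S) u v ≡ true → ∃[ i ] ∃[ j ] (f i ≡ u × f j ≡ v × edge S i j ≡ true)
  edge-push⁻ S u v e
    with i , fi , e′ ← extend-true (fiber? f u) (trans (sym (edge-push S u v)) e)
    with j , fj , e″ ← extend-true (fiber? f v) e′ = i , j , fi , fj , e″

  module _ (f-inj : Injective _≡_ _≡_ f) where

    vertex-push-image : ∀ S i → lookup (vertices (push S)) (f i) ≡ lookup (vertices S) i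
    vertex-push-image S i = trans (vertex-push S (f i))
      (extend-image f-inj (fiber? f (f i)) (lookup (vertices S)))

    edge-push-image : ∀ S i j → edge (push S) (f i) (f j) ≡ edge S i j
    edge-push-image S i j = trans (edge-push S (f i) (f j))
      (trans (extend-image f-inj (fiber? f (f i)) (λ i → extend (fiber? f (f j)) (edge S i)))
             (extend-image f-inj (fiber? f (f j)) (edge S i)))

    ∈-push⁺ : ∀ S {i} → i ∈ vertices S → f i ∈ vertices (push S)
    ∈-push⁺ S {i} i∈ = lookup⇒[]= (f i) (vertices (push S)) (trans (vertex-push-image S i) ([]=⇒lookup i∈))

    -- This left inverse makes `push` injective, so that distinct copies in the small graph stay
    -- distinct in the large one.
    pull∘push : ∀ S → pull f (push S) ≡ S
    pull∘push S = Sub-ext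
      (λ i → trans (vertex-pull f (push S) i) (vertex-push-image S i))
      (λ i j → trans (edge-pull f (push S) i j) (edge-push-image S i j))

    push-injective : Injective _≡_ _≡_ push
    push-injective eq = trans (sym (pull∘push _)) (trans (cong (pull f) eq) (pull∘push _))

    -- Every edge of `push S` is the image of an edge of `S`, which `hom` carries into `G`; the
    -- isomorphism onto `S` is composed with `f`.
    push-isCopy : (T : Graph t) (H : Graph n) (G : Graph N) →
      (∀ i j → adj H i j ≡ true → adj G (f i) (f j) ≡ true) → ∀ S → IsCopy T H S → IsCopy T G (push S)
    push-isCopy T H G hom S ((symm , sound) , φ , φ-inj , φ-in , φ-onto , φ-edge) =
        ( (λ u v → Bool.⇔→≡ (mk⇔ (swap u v) (swap v u))) , sound′ )
      , Vec.map f φ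
      , (λ {i} {j} eq → φ-inj (f-inj (trans (sym (lookup-map i f φ)) (trans eq (lookup-map j f φ)))))
      , (λ i → subst (_∈ vertices (push S)) (sym (lookup-map i f φ)) (∈-push⁺ S (φ-in i)))
      , onto
      , (λ i j → trans (cong₂ (edge (push S)) (lookup-map i f φ) (lookup-map j f φ))
                       (trans (edge-push-image S _ _) (φ-edge i j)))
      where
      swap : ∀ u v → edge (push S) u v ≡ true → edge (push S) v u ≡ true
      swap u v e with i , j , refl , refl , e′ ← edge-push⁻ S u v e =
        trans (edge-push-image S j i) (trans (symm j i) e′)

      sound′ : ∀ u v → edge (push S) u v ≡ true → u ∈ vertices (push S) × adj G u v ≡ true
      sound′ u v e with i , j , refl , refl , e′ ← edge-push⁻ S u v e =
        ∈-push⁺ S (proj₁ (sound i j e′)) , hom i j (proj₂ (sound i j e′))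

      onto : ∀ v → v ∈ vertices (push S) → ∃[ i ] lookup (Vec.map f φ) i ≡ v
      onto v v∈ with j , refl , j∈ ← ∈-push⁻ S v∈ with i , refl ← φ-onto j j∈ = i , lookup-map i f φ

  -- Edges of a subgraph join its own vertices, so once the vertices lie in the range of `f`, the
  -- edges do too and restriction loses nothing.
  push∘pull : (G : Graph N) (S : Sub N) → IsSubgraph G S →
    (∀ v → v ∈ vertices S → Fiber f v) → push (pull f S) ≡ S
  push∘pull G S (symm , sound) ⊆range = Sub-ext
    (λ v → trans (vertex-push (pull f S) v)
      (extend-unique (fiber? f v) (λ { i refl → vertex-pull f S i }) (λ v∈ → ⊆range v (lookup⇒[]= _ _ v∈))))
    (λ u v → trans (edge-push (pull f S) u v)
      (extend-unique (fiber? f u)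
        (λ { i refl → extend-unique (fiber? f v) (λ { j refl → edge-pull f S i j })
                        -- `sound` yields the first endpoint of an edge only, so the edge is
                        -- reversed by symmetry to reach `v`.
                        (λ e → ⊆range v (proj₁ (sound v u (trans (symm v u) e)))) })
        (λ e → ⊆range u (proj₁ (sound u v e)))))

  -- An edge of `S` between image vertices is an edge of `G`, and `induced` reflects it to an edge
  -- of `H`. The isomorphism is lifted by choosing preimages.
  pull-isCopy : (T : Graph t) (H : Graph n) (G : Graph N) → Injective _≡_ _≡_ f →
    (∀ i j → adj G (f i) (f j) ≡ adj H i j) → ∀ S → IsCopy T G S →
    (∀ v → v ∈ vertices S → Fiber f v) → IsCopy T H (pull f S)
  pull-isCopy {t = t} T H G f-inj induced S ((symm , sound) , φ , φ-inj , φ-in , φ-onto , φ-edge) ⊆range =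
      ( (λ i j → trans (edge-pull f S i j) (trans (symm (f i) (f j)) (sym (edge-pull f S j i))))
      , (λ i j e → let (i∈ , a) = sound (f i) (f j) (trans (sym (edge-pull f S i j)) e)
                   in ∈-pull⁺ f S i∈ , trans (sym (induced i j)) a) )
    , ψ
    , (λ {i} {j} eq → φ-inj (trans (sym (f∘ψ i)) (trans (cong f eq) (f∘ψ j))))
    , (λ i → ∈-pull⁺ f S (subst (_∈ vertices S) (sym (f∘ψ i)) (φ-in i)))
    , (λ v v∈ → let (i , eq) = φ-onto (f v) (∈-pull⁻ f S v∈) in i , f-inj (trans (f∘ψ i) eq))
    , (λ i j → trans (edge-pull f S _ _) (trans (cong₂ (edge S) (f∘ψ i) (f∘ψ j)) (φ-edge i j)))
    where
    preimage : ∀ i → Fiber f (lookup φ i)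
    preimage i = ⊆range _ (φ-in i)

    ψ : Vec (Fin n) t
    ψ = tabulate (proj₁ ∘ preimage)

    f∘ψ : ∀ i → f (lookup ψ i) ≡ lookup φ i
    f∘ψ i = trans (cong f (lookup∘tabulate (proj₁ ∘ preimage) i)) (proj₂ (preimage i))

-- Coverings by embeddings.

-- Non-adjacency may be lost, in accordance with copies of `H` that are not necessarily induced.
Embedding : Graph n → Graph N → (Fin n → Fin N) → Set
Embedding H G f = Injective _≡_ _≡_ f × (∀ i j → adj H i j ≡ true → adj G (f i) (f j) ≡ true)

CoveredByEmbeddings : Graph n → Graph N → Set
CoveredByEmbeddings H G = ∀ v → ∃[ f ] (Embedding H G f × Fiber f v)

Covered⇒embeddings : {H : Graph n} {G : Graph N} → Covered H G → CoveredByEmbeddings H G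
Covered⇒embeddings cov v
  with S , ((_ , sound) , φ , φ-inj , _ , φ-onto , φ-edge) , v∈ ← cov v =
  lookup φ , (φ-inj , λ i j ij → proj₂ (sound _ _ (trans (φ-edge i j) ij))) , φ-onto v v∈

-- Its push along an embedding is the copy of `H` that witnesses `Covered`.
whole : Graph n → Sub n
whole H = fromMatrix (λ _ → true) (adj H)

∈-whole : (H : Graph n) → ∀ v → v ∈ vertices (whole H)
∈-whole H v = lookup⇒[]= v _ (lookup∘tabulate (λ _ → true) v)

edge-whole : (H : Graph n) → ∀ u v → edge (whole H) u v ≡ adj H u v
edge-whole H = edge-fromMatrix (λ _ → true) (adj H)

whole-isCopy : (H : Graph n) → IsCopy H H (whole H)
whole-isCopy {n} H =
    ( (λ u v → trans (edge-whole H u v) (trans (symmetric H u v) (sym (edge-whole H v u))))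
    , (λ u v e → ∈-whole H u , trans (sym (edge-whole H u v)) e) )
  , Vec.allFin n
  , (λ {i} {j} eq → trans (sym (lookup∘tabulate id i)) (trans eq (lookup∘tabulate id j)))
  , (λ i → ∈-whole H _)
  , (λ v _ → v , lookup∘tabulate id v)
  , (λ i j → trans (edge-whole H _ _) (cong₂ (adj H) (lookup∘tabulate id i) (lookup∘tabulate id j)))

embeddings⇒Covered : {H : Graph n} {G : Graph N} → CoveredByEmbeddings H G → Covered H G
embeddings⇒Covered {H = H} {G} cov v with f , (f-inj , hom) , i , refl ← cov v =
  push f (whole H) , push-isCopy f f-inj H H G hom (whole H) (whole-isCopy H) ,
  ∈-push⁺ f f-inj (whole H) (∈-whole H i)

-- Multisets of sizes and the greedy lower bound.

-- A list ks stands for the feasible point x with x_n one more than the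
-- multiplicity of n in ks, and x_k the multiplicity of k otherwise.

total : (Fin (suc n) → ℕ) → List (Fin (suc n)) → ℕ
total {n} w = foldr (λ k c → w k + c) (w (fromℕ n))

index-last : ∀ n → index (fromℕ n) ≡ suc n
index-last n = cong suc (toℕ-fromℕ n)

index-onto : ∀ {m} → 0 < m → m ≤ n → ∃[ k ] index {n} k ≡ m
index-onto {m = suc _} _ m≤n = fromℕ< m≤n , cong suc (toℕ-fromℕ< m≤n)

module _ (T : Graph t) (H : Graph (suc n)) (G : Graph N) where

  open DecMembership (_≟_ {N}) using () renaming (_∈?_ to _∈ˡ?_)

  private
    a : ℕ → ℕ
    a = minCopiesMeeting T H

  -- A state of the greedy cover: `us` lists the vertices covered so far, `ks` the numbers of
  -- vertices gained after the first step, and `family` the copies of `T` counted so far.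
  record Packing (us : List (Fin N)) (ks : List (Fin (suc n))) : Set where
    field
      us-unique     : Unique us
      us-length     : length us ≡ total index ks
      family        : List (Sub N)
      family-unique : Unique family
      family-copies : All (IsCopy T G) family
      family-inside : All (λ S → ∀ v → v ∈ vertices S → v ∈ˡ us) family
      family-large  : total (a ∘ index) ks ≤ length family

  open Packing

  -- The first copy of `H` gains `suc n` vertices, which is what `total` assigns to the empty list.
  -- For the count, a(`suc n`) is compared with the copies of `T` that meet the full vertex set.
  firstPacking : ∀ {f} → Embedding H G f → Packing (List.map f (allFin (suc n))) []
  firstPacking {f} (f-inj , hom) = record
    { us-unique     = Unique.map⁺ f-inj (Unique.allFin⁺ (suc n))
    ; us-length     = trans (length-map f (allFin (suc n))) (trans (length-tabulate id) (sym (index-last n)))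
    ; family        = List.map (push f) (copies T H)
    ; family-unique = Unique.map⁺ (push-injective f f-inj) (copies-unique T H)
    ; family-copies = All.map⁺ (All.tabulate λ {S} S∈ → push-isCopy f f-inj T H G hom S (∈-copies⁻ T H S∈))
    ; family-inside = All.map⁺ (All.tabulate λ {S} _ _ v∈ → inside-image S v∈)
    ; family-large  = begin
        a (index (fromℕ n))                      ≡⟨ cong a (index-last n) ⟩
        a (suc n)                                ≡⟨ cong a (∣⊤∣≡n (suc n)) ⟨
        a ∣ ⊤ {suc n} ∣                          ≤⟨ minCopiesMeeting≤ T H ⊤ ⟩
        #copiesMeeting T H ⊤                     ≤⟨ length-filter _ (copies T H) ⟩
        #copies T H                              ≡⟨ length-map (push f) (copies T H) ⟨
        length (List.map (push f) (copies T H)) ∎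
    }
    where
    open ℕ.≤-Reasoning

    inside-image : ∀ S {v} → v ∈ vertices (push f S) → v ∈ˡ List.map f (allFin (suc n))
    inside-image S v∈ with i , refl , _ ← ∈-push⁻ f S v∈ = ∈-map⁺ f (∈-allFin i)

  -- Let `fresh` be the vertices of `H` that `f` sends outside `us`. The copies of `T` meeting
  -- `fresh` are pushed into `G`; each contains an uncovered vertex, whereas the old family lies
  -- inside `us`, so nothing is counted twice.
  growPacking : ∀ {us ks f v} → Packing us ks → Embedding H G f → Fiber f v → v ∉ˡ us →
    ∃[ us′ ] ∃[ ks′ ] (Packing us′ ks′ × (∀ {u} → u ∈ˡ us → u ∈ˡ us′) × v ∈ˡ us′)
  growPacking {us} {ks} {f} {v} P (f-inj , hom) (i , refl) v∉ =
    us′ , k ∷ ks , P′ , ∈-++⁺ʳ new , ∈-++⁺ˡ (∈-map⁺ f (∈-elements⁺ (∈-fresh⁺ v∉)))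
    where
    isFresh : Fin (suc n) → Bool
    isFresh i = does (¬? (f i ∈ˡ? us))

    fresh : Subset (suc n)
    fresh = tabulate isFresh

    ∈-fresh⁺ : ∀ {i} → f i ∉ˡ us → i ∈ fresh
    ∈-fresh⁺ {i} fi∉ = lookup⇒[]= i fresh (trans (lookup∘tabulate isFresh i) (dec-true (¬? (f i ∈ˡ? us)) fi∉))

    ∈-fresh⁻ : ∀ {i} → i ∈ fresh → f i ∉ˡ us
    ∈-fresh⁻ {i} i∈ fi∈ with () ← trans (sym (dec-false (¬? (f i ∈ˡ? us)) (λ fi∉ → fi∉ fi∈)))
                                        (trans (sym (lookup∘tabulate isFresh i)) ([]=⇒lookup i∈))

    new : List (Fin N)
    new = List.map f (elements fresh)

    us′ : List (Fin N)
    us′ = new ++ us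

    new-length : length new ≡ ∣ fresh ∣
    new-length = trans (length-map f (elements fresh)) (length-elements fresh)

    -- The values of `index` start at 1; the preimage of the uncovered vertex `v` makes the size
    -- positive.
    fresh-nonempty : 0 < ∣ fresh ∣
    fresh-nonempty = subst (0 <_) (length-elements fresh) (nonempty-length (∈-elements⁺ (∈-fresh⁺ v∉)))
      where
      nonempty-length : ∀ {x} {xs : List (Fin (suc n))} → x ∈ˡ xs → 0 < length xs
      nonempty-length {xs = _ ∷ _} _ = s≤s z≤n

    k : Fin (suc n)
    k = proj₁ (index-onto fresh-nonempty (∣p∣≤n fresh))

    index-k : index k ≡ ∣ fresh ∣
    index-k = proj₂ (index-onto fresh-nonempty (∣p∣≤n fresh))

    meetsFresh? : (S : Sub (suc n)) → Dec _
    meetsFresh? S = nonempty? (fresh ∩ vertices S)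

    meeting : List (Sub (suc n))
    meeting = filter meetsFresh? (copies T H)

    ∈-meeting⁻ : ∀ {S} → S ∈ˡ meeting → IsCopy T H S × ∃[ i ] (i ∈ fresh × i ∈ vertices S)
    ∈-meeting⁻ {S} S∈ with S∈copies , (i , i∈) ← ∈-filter⁻ meetsFresh? {xs = copies T H} S∈ =
      ∈-copies⁻ T H S∈copies , i , x∈p∩q⁻ fresh (vertices S) i∈

    newFamily : List (Sub N)
    newFamily = List.map (push f) meeting

    new-disjoint : ∀ {u} → ¬ (u ∈ˡ new × u ∈ˡ us)
    new-disjoint (u∈new , u∈us) with j , j∈ , refl ← ∈-map⁻ f u∈new = ∈-fresh⁻ (∈-elements⁻ fresh j∈) u∈us

    newFamily-disjoint : ∀ {S} → ¬ (S ∈ˡ newFamily × S ∈ˡ family P)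
    newFamily-disjoint (S∈new , S∈old)
      with S′ , S′∈ , refl ← ∈-map⁻ (push f) S∈new
      with _ , j , j∈fresh , j∈S′ ← ∈-meeting⁻ S′∈ =
      ∈-fresh⁻ j∈fresh (All.lookup (family-inside P) S∈old _ (∈-push⁺ f f-inj S′ j∈S′))

    inside-new : ∀ S {u} → u ∈ vertices (push f S) → u ∈ˡ us′
    inside-new S u∈ with j , refl , _ ← ∈-push⁻ f S u∈ with f j ∈ˡ? us
    ... | yes fj∈ = ∈-++⁺ʳ new fj∈
    ... | no  fj∉ = ∈-++⁺ˡ (∈-map⁺ f (∈-elements⁺ (∈-fresh⁺ fj∉)))

    open ℕ.≤-Reasoning

    P′ : Packing us′ (k ∷ ks)
    P′ = record
      { us-unique     = Unique.++⁺ (Unique.map⁺ f-inj (elements-unique fresh)) (us-unique P) new-disjoint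
      ; us-length     = trans (length-++ new) (cong₂ _+_ (trans new-length (sym index-k)) (us-length P))
      ; family        = newFamily ++ family P
      ; family-unique = Unique.++⁺
          (Unique.map⁺ (push-injective f f-inj) (Unique.filter⁺ meetsFresh? (copies-unique T H)))
          (family-unique P) newFamily-disjoint
      ; family-copies = All.++⁺
          (All.map⁺ (All.tabulate λ {S} S∈ → push-isCopy f f-inj T H G hom S (proj₁ (∈-meeting⁻ S∈))))
          (family-copies P)
      ; family-inside = All.++⁺
          (All.map⁺ (All.tabulate λ {S} _ _ u∈ → inside-new S u∈))
          (All.map (λ S⊆us u u∈ → ∈-++⁺ʳ new (S⊆us u u∈)) (family-inside P))
      ; family-large  = begin
          a (index k) + total (a ∘ index) ks    ≡⟨ cong (λ m → a m + total (a ∘ index) ks) index-k ⟩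
          a ∣ fresh ∣ + total (a ∘ index) ks    ≤⟨ ℕ.+-mono-≤ (minCopiesMeeting≤ T H fresh) (family-large P) ⟩
          length meeting + length (family P)    ≡⟨ cong (_+ length (family P)) (length-map (push f) meeting) ⟨
          length newFamily + length (family P)  ≡⟨ length-++ newFamily ⟨
          length (newFamily ++ family P)        ∎
      }

  -- The packing grows only at those vertices of the list that are still uncovered. The vertex `v₀`
  -- provides the embedding for the first step.
  covering⇒packing : CoveredByEmbeddings H G → Fin N → ∀ (vs : List (Fin N)) →
    ∃[ us ] ∃[ ks ] (Packing us ks × (∀ {v} → v ∈ˡ vs → v ∈ˡ us))
  covering⇒packing cov v₀ [] = _ , _ , firstPacking (proj₁ (proj₂ (cov v₀))) , λ ()
  covering⇒packing cov v₀ (v ∷ vs) with us , ks , P , vs⊆us ← covering⇒packing cov v₀ vs with v ∈ˡ? us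
  ... | yes v∈ = us , ks , P , λ { (here refl) → v∈ ; (there u∈) → vs⊆us u∈ }
  ... | no  v∉ with f , emb , fib ← cov v with us′ , ks′ , P′ , us⊆us′ , v∈us′ ← growPacking P emb fib v∉ =
    us′ , ks′ , P′ , λ { (here refl) → v∈us′ ; (there u∈) → us⊆us′ (vs⊆us u∈) }

  -- Run over all vertices, the greedy cover makes `us` a repetition-free list of the whole vertex
  -- set, hence of length `N`, while `family` is a repetition-free list of copies of `T` in `G`.
  covered⇒total : CoveredByEmbeddings H G → Fin N →
    ∃[ ks ] (total index ks ≡ N × total (a ∘ index) ks ≤ #copies T G)
  covered⇒total cov v₀ with us , ks , P , all∈us ← covering⇒packing cov v₀ (allFin N) =
    ks , trans (sym (us-length P)) (ℕ.≤-antisym length≤N N≤length) ,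
    ℕ.≤-trans (family-large P)
      (Unique-⊆⇒length≤ (family-unique P) (λ {S} S∈ → ∈-copies⁺ T G {S} (All.lookup (family-copies P) S∈)))
    where
    length≤N : length us ≤ N
    length≤N = subst (length us ≤_) (length-tabulate id) (Unique-⊆⇒length≤ (us-unique P) (λ _ → ∈-allFin _))

    N≤length : N ≤ length us
    N≤length = subst (_≤ length us) (length-tabulate id) (Unique-⊆⇒length≤ (Unique.allFin⁺ N) all∈us)

-- Cheap covered graphs by gluing.

-- Distinct vertices come from distinct, hence adjacent, vertices of `K t`. This is where the
-- construction uses that cliques are being counted.
clique-adjacent : ∀ {G : Graph N} S → IsCopy (K t) G S →
  ∀ {u v} → u ∈ vertices S → v ∈ vertices S → u ≢ v → adj G u v ≡ true
clique-adjacent S ((_ , sound) , φ , _ , _ , φ-onto , φ-edge) u∈ v∈ u≢v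
  with i , refl ← φ-onto _ u∈ with j , refl ← φ-onto _ v∈ =
  proj₂ (sound _ _ (trans (φ-edge i j) (cong not (dec-false (i ≟ j) (u≢v ∘ cong (lookup φ))))))

-- `base` is an induced copy of `H` onto which the next one is glued; `glue` makes the copy just
-- added the new base. A list `family` containing every clique suffices to bound their number by
-- `c`.
record Construction (t : ℕ) (H : Graph n) (M c : ℕ) : Set where
  field
    graph           : Graph M
    covering        : CoveredByEmbeddings H graph
    base            : Fin n → Fin M
    base-injective  : Injective _≡_ _≡_ base
    base-induced    : ∀ i j → adj graph (base i) (base j) ≡ adj H i j
    family          : List (Sub M)
    family-complete : ∀ S → IsCopy (K t) graph S → S ∈ˡ family
    family-small    : length family ≤ c

open Construction

-- A clique on at least one vertex meets the full vertex set, which is the only subset of size `n`;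
-- so a(`n`) counts all cliques of `H`.
initialConstruction : (H : Graph n) → Construction (suc t) H n (minCopiesMeeting (K (suc t)) H n)
initialConstruction {n} {t} H = record
  { graph           = H
  ; covering        = λ v → id , (id , λ _ _ ij → ij) , v , refl
  ; base            = id
  ; base-injective  = id
  ; base-induced    = λ _ _ → refl
  ; family          = copies T H
  ; family-complete = λ S → ∈-copies⁺ T H {S}
  ; family-small    = small (minCopiesMeeting-attained T H ℕ.≤-refl)
  }
  where
  T : Graph (suc t)
  T = K (suc t)

  all-meet : ∀ S → IsCopy T H S → ∃[ v ] v ∈ ⊤ ∩ vertices S
  all-meet S (_ , φ , _ , φ-in , _) = lookup φ zero , x∈p∩q⁺ (∈⊤ , φ-in zero)

  filter-meets : filter (λ S → nonempty? (⊤ ∩ vertices S)) (copies T H) ≡ copies T H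
  filter-meets = filter-all (λ S → nonempty? (⊤ ∩ vertices S))
    (All.tabulate λ {S} S∈ → all-meet S (∈-copies⁻ T H S∈))

  small : ∀ {c} → ∃[ p ] (∣ p ∣ ≡ n × #copiesMeeting T H p ≡ c) → #copies T H ≤ c
  small (p , ∣p∣≡n , refl) with refl ← ∣p∣≡n⇒p≡⊤ {p = p} ∣p∣≡n = ℕ.≤-reflexive (cong length (sym filter-meets))

module _ {H : Graph n} (C : Construction t H M c) (p : Subset n) where

  private
    es : List (Fin n)
    es = elements p

    k : ℕ
    k = length es

    label : Fin k → Fin n
    label = List.lookup es

    slot : ∀ {b} → b ∈ p → Fin k
    slot b∈p = position (∈-elements⁺ b∈p)

    label-slot : ∀ {b} (b∈p : b ∈ p) → label (slot b∈p) ≡ b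
    label-slot b∈p = sym (lookup-index (∈-elements⁺ b∈p))

    label∈ : ∀ j → label j ∈ p
    label∈ j = ∈-elements⁻ p (∈-lookup j)

    -- The new vertex `j` is joined to the old vertex `u` when `u` is the base position of a shared
    -- vertex `b`, one outside `p`, that is adjacent to `label j` in `H`. All other old vertices
    -- stay non-adjacent to `j`.
    IsLink : Fin k → Fin M → Fin n → Set
    IsLink j u b = base C b ≡ u × (¬ b ∈ p) × adj H (label j) b ≡ true

    link? : ∀ j u → Dec (∃ (IsLink j u))
    link? j u = any? λ b → (base C b ≟ u) ×-dec ¬? (b ∈? p) ×-dec (adj H (label j) b Bool.≟ true)

    adj⊎ : Fin k ⊎ Fin M → Fin k ⊎ Fin M → Bool
    adj⊎ (inj₁ i) (inj₁ j) = adj H (label i) (label j)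
    adj⊎ (inj₁ i) (inj₂ v) = does (link? i v)
    adj⊎ (inj₂ u) (inj₁ j) = does (link? j u)
    adj⊎ (inj₂ u) (inj₂ v) = adj (graph C) u v

    adj⊎-sym : ∀ x y → adj⊎ x y ≡ adj⊎ y x
    adj⊎-sym (inj₁ i) (inj₁ j) = symmetric H (label i) (label j)
    adj⊎-sym (inj₁ i) (inj₂ v) = refl
    adj⊎-sym (inj₂ u) (inj₁ j) = refl
    adj⊎-sym (inj₂ u) (inj₂ v) = symmetric (graph C) u v

    adj⊎-irrefl : ∀ x → adj⊎ x x ≡ false
    adj⊎-irrefl (inj₁ i) = irreflexive H (label i)
    adj⊎-irrefl (inj₂ u) = irreflexive (graph C) u

    glued : Graph (k + M)
    glued = record
      { adj         = λ u v → adj⊎ (splitAt k u) (splitAt k v)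
      ; symmetric   = λ u v → adj⊎-sym (splitAt k u) (splitAt k v)
      ; irreflexive = λ v → adj⊎-irrefl (splitAt k v)
      }

    adj-join : ∀ x y → adj glued (join k M x) (join k M y) ≡ adj⊎ x y
    adj-join x y = cong₂ adj⊎ (splitAt-join k M x) (splitAt-join k M y)

    join-injective : ∀ {x y} → join k M x ≡ join k M y → x ≡ y
    join-injective {x} {y} eq =
      trans (sym (splitAt-join k M x)) (trans (cong (splitAt k) eq) (splitAt-join k M y))

    join-onto : ∀ v → ∃[ x ] join k M x ≡ v
    join-onto v = splitAt k v , join-splitAt k M v

    place : ∀ {b} → Dec (b ∈ p) → Fin k ⊎ Fin M
    place     (yes b∈p) = inj₁ (slot b∈p)
    place {b} (no _)    = inj₂ (base C b)

    place-injective : ∀ {b c} (d : Dec (b ∈ p)) (e : Dec (c ∈ p)) → place d ≡ place e → b ≡ c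
    place-injective (yes b∈p) (yes c∈p) eq =
      trans (sym (label-slot b∈p)) (trans (cong label (inj₁-injective eq)) (label-slot c∈p))
    place-injective (no _) (no _) eq = base-injective C (inj₂-injective eq)

    -- A link is witnessed by some `c′` with the same base position as `c`, and injectivity of the
    -- base identifies the two.
    linked : ∀ {b c} (b∈p : b ∈ p) → ¬ c ∈ p → does (link? (slot b∈p) (base C c)) ≡ adj H b c
    linked {b} {c} b∈p c∉p = Bool.⇔→≡ (mk⇔
      (from (link? (slot b∈p) (base C c)))
      (λ bc → dec-true (link? (slot b∈p) (base C c))
                (c , refl , c∉p , trans (cong (λ a → adj H a c) (label-slot b∈p)) bc)))
      where
      from : (d : Dec (∃ (IsLink (slot b∈p) (base C c)))) → does d ≡ true → adj H b c ≡ true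
      from (yes (c′ , eq , _ , bc′)) _ =
        trans (cong₂ (adj H) (sym (label-slot b∈p)) (sym (base-injective C eq))) bc′

    place-induced : ∀ {b c} (d : Dec (b ∈ p)) (e : Dec (c ∈ p)) → adj⊎ (place d) (place e) ≡ adj H b c
    place-induced (yes b∈p) (yes c∈p) = cong₂ (adj H) (label-slot b∈p) (label-slot c∈p)
    place-induced (yes b∈p) (no c∉p)  = linked b∈p c∉p
    place-induced {b} {c} (no b∉p) (yes c∈p) = trans (linked c∈p b∉p) (symmetric H c b)
    place-induced {b} {c} (no _)  (no _)  = base-induced C b c

    place-label : ∀ j (d : Dec (label j ∈ p)) → place d ≡ inj₁ j
    place-label j (yes ∈p) = cong inj₁ (Unique⇒lookup-injective (elements-unique p) (label-slot ∈p))
    place-label j (no ∉p)  = contradiction (label∈ j) ∉p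

    place-outside : ∀ {b} (d : Dec (b ∈ p)) → ¬ b ∈ p → place d ≡ inj₂ (base C b)
    place-outside (yes b∈p) b∉p = contradiction b∈p b∉p
    place-outside (no _)    _   = refl

    copy : Fin n → Fin (k + M)
    copy b = join k M (place (b ∈? p))

    copy-injective : Injective _≡_ _≡_ copy
    copy-injective {b} {c} eq = place-injective (b ∈? p) (c ∈? p) (join-injective eq)

    copy-induced : ∀ b c → adj glued (copy b) (copy c) ≡ adj H b c
    copy-induced b c = trans (adj-join (place (b ∈? p)) (place (c ∈? p))) (place-induced (b ∈? p) (c ∈? p))

    copy-label : ∀ j → copy (label j) ≡ join k M (inj₁ j)
    copy-label j = cong (join k M) (place-label j (label j ∈? p))

    old : Fin M → Fin (k + M)
    old = k ↑ʳ_

    old-induced : ∀ u v → adj glued (old u) (old v) ≡ adj (graph C) u v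
    old-induced u v = adj-join (inj₂ u) (inj₂ v)

    old-injective : Injective _≡_ _≡_ old
    old-injective = ↑ʳ-injective k _ _

    -- A linked old vertex is the base position of some `b` outside `p`, and that is where the new
    -- copy places `b`.
    neighbour⊆copy : ∀ j x → adj⊎ (inj₁ j) x ≡ true → Fiber copy (join k M x)
    neighbour⊆copy j (inj₁ i) _ = label i , copy-label i
    neighbour⊆copy j (inj₂ u) e with link? j u
    neighbour⊆copy j (inj₂ u) _ | yes (b , refl , b∉p , _) = b , cong (join k M) (place-outside (b ∈? p) b∉p)

    glued-covering : CoveredByEmbeddings H glued
    glued-covering v with join-onto v
    ... | inj₁ j , refl =
      copy , (copy-injective , λ b c bc → trans (copy-induced b c) bc) , label j , copy-label j
    ... | inj₂ u , refl with f , (f-inj , hom) , i , refl ← covering C u =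
      old ∘ f , (f-inj ∘ old-injective , λ i j ij → trans (old-induced (f i) (f j)) (hom i j ij)) , i , refl

    meeting : List (Sub n)
    meeting = filter (λ S → nonempty? (p ∩ vertices S)) (copies (K t) H)

    glued-family : List (Sub (k + M))
    glued-family = List.map (push copy) meeting ++ List.map (push old) (family C)

    -- All vertices of a clique with a new vertex are that vertex or its neighbours, so the clique
    -- lies in the new copy and pulls back to a clique of `H` meeting `p`. Any other clique has old
    -- vertices only and pulls back to the previous graph.
    glued-complete : ∀ S → IsCopy (K t) glued S → S ∈ˡ glued-family
    glued-complete S S-copy with any? (λ j → join k M (inj₁ j) ∈? vertices S)
    ... | yes (j , j∈) = ∈-++⁺ˡ (subst (_∈ˡ List.map (push copy) meeting)
      (push∘pull copy glued S (proj₁ S-copy) ⊆copy)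
      (∈-map⁺ (push copy) (∈-filter⁺ (λ S → nonempty? (p ∩ vertices S))
        (∈-copies⁺ (K t) H {pull copy S}
          (pull-isCopy copy (K t) H glued copy-injective copy-induced S S-copy ⊆copy))
        (label j , x∈p∩q⁺ (label∈ j , ∈-pull⁺ copy S (subst (_∈ vertices S) (sym (copy-label j)) j∈))))))
      where
      ⊆copy : ∀ v → v ∈ vertices S → Fiber copy v
      ⊆copy v v∈ with x , refl ← join-onto v with join k M (inj₁ j) ≟ join k M x
      ... | yes eq = label j , trans (copy-label j) eq
      ... | no  ≢x = neighbour⊆copy j x (trans (sym (adj-join (inj₁ j) x))
        (clique-adjacent {G = glued} S S-copy j∈ v∈ ≢x))
    ... | no ∉new = ∈-++⁺ʳ (List.map (push copy) meeting) (subst (_∈ˡ List.map (push old) (family C))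
      (push∘pull old glued S (proj₁ S-copy) ⊆old)
      (∈-map⁺ (push old) (family-complete C (pull old S)
        (pull-isCopy old (K t) (graph C) glued old-injective old-induced S S-copy ⊆old))))
      where
      ⊆old : ∀ v → v ∈ vertices S → Fiber old v
      ⊆old v v∈ with join-onto v
      ... | inj₁ j , refl = contradiction (j , v∈) ∉new
      ... | inj₂ u , refl = u , refl

    glued-small : length glued-family ≤ #copiesMeeting (K t) H p + c
    glued-small = begin
      length glued-family
        ≡⟨ length-++ (List.map (push copy) meeting) ⟩
      length (List.map (push copy) meeting) + length (List.map (push old) (family C))
        ≡⟨ cong₂ _+_ (length-map (push copy) meeting) (length-map (push old) (family C)) ⟩
      length meeting + length (family C)
        ≤⟨ ℕ.+-monoʳ-≤ (length meeting) (family-small C) ⟩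
      length meeting + c ∎
      where open ℕ.≤-Reasoning

  glue : Construction t H (∣ p ∣ + M) (#copiesMeeting (K t) H p + c)
  glue = subst (λ m → Construction t H (m + M) (#copiesMeeting (K t) H p + c)) (length-elements p) record
    { graph           = glued
    ; covering        = glued-covering
    ; base            = copy
    ; base-injective  = copy-injective
    ; base-induced    = copy-induced
    ; family          = glued-family
    ; family-complete = glued-complete
    ; family-small    = glued-small
    }

construction : (H : Graph (suc n)) → ∀ ks →
  Construction (suc t) H (total index ks) (total (minCopiesMeeting (K (suc t)) H ∘ index) ks)
construction {n} {t} H [] =
  subst (λ m → Construction (suc t) H m (minCopiesMeeting (K (suc t)) H m))
    (sym (index-last n)) (initialConstruction H)
construction {t = t} H (k ∷ ks) = glueCheapest (minCopiesMeeting-attained (K (suc t)) H (toℕ<n k))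
  where
  glueCheapest : ∀ {m c} → ∃[ p ] (∣ p ∣ ≡ m × #copiesMeeting (K (suc t)) H p ≡ c) →
    Construction (suc t) H (m + total index ks) (c + total (minCopiesMeeting (K (suc t)) H ∘ index) ks)
  glueCheapest (p , refl , refl) = glue (construction H ks) p

total⇒covered : (H : Graph (suc n)) → ∀ ks →
  ∃[ G ] (Covered {N = total index ks} H G
         × #copies (K (suc t)) G ≤ total (minCopiesMeeting (K (suc t)) H ∘ index) ks)
total⇒covered {t = t} H ks =
  graph C , embeddings⇒Covered {H = H} {graph C} (covering C) ,
  ℕ.≤-trans (Unique-⊆⇒length≤ (copies-unique (K (suc t)) (graph C))
              (λ {S} S∈ → family-complete C S (∈-copies⁻ (K (suc t)) (graph C) S∈)))
            (family-small C)
  where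
  C = construction {t = t} H ks

-- Lists of sizes as feasible points of the integer program.

-- Applied with `d` equal to 1 to build a feasible point from a list, and to -1 to take the
-- mandatory unit off the last coordinate.
sum-updateAt : (w x : Fin n → ℤ) (k : Fin n) (d : ℤ) →
  sum (λ i → w i ℤ.* updateAt x k (ℤ._+_ d) i) ≡ w k ℤ.* d ℤ.+ sum (λ i → w i ℤ.* x i)
sum-updateAt w x zero d = trans
  (cong (ℤ._+ sum (λ i → w (suc i) ℤ.* x (suc i))) (ℤ.*-distribˡ-+ (w zero) d (x zero)))
  (ℤ.+-assoc (w zero ℤ.* d) _ _)
sum-updateAt w x (suc k) d = trans
  (cong (λ s → w zero ℤ.* x zero ℤ.+ s) (sum-updateAt (w ∘ suc) (x ∘ suc) k d))
  (x∙yz≈y∙xz (w zero ℤ.* x zero) (w (suc k) ℤ.* d) _)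

sum-zero : (w : Fin n → ℤ) → sum (λ i → w i ℤ.* 0ℤ) ≡ 0ℤ
sum-zero {zero}  w = refl
sum-zero {suc n} w = cong₂ ℤ._+_ (ℤ.*-zeroʳ (w zero)) (sum-zero (w ∘ suc))

increment : Fin n → (Fin n → ℤ) → Fin n → ℤ
increment k x = updateAt x k ℤ.suc

sum-increment : (w : Fin n → ℤ) (k : Fin n) (x : Fin n → ℤ) →
  sum (λ i → w i ℤ.* increment k x i) ≡ w k ℤ.+ sum (λ i → w i ℤ.* x i)
sum-increment w k x = trans (sum-updateAt w x k 1ℤ) (cong (ℤ._+ _) (ℤ.*-identityʳ (w k)))

increment-≥ : (k : Fin n) (x : Fin n → ℤ) → ∀ i → x i ℤ.≤ increment k x i
increment-≥ zero    x zero    = ℤ.i≤suc[i] (x zero)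
increment-≥ zero    x (suc i) = ℤ.≤-refl
increment-≥ (suc k) x zero    = ℤ.≤-refl
increment-≥ (suc k) x (suc i) = increment-≥ k (x ∘ suc) i

-- The innermost increment, at the last coordinate, is the unit demanded by the constraint on x_n
-- and matches the starting value of `total`.
multiplicity : List (Fin (suc n)) → Fin (suc n) → ℤ
multiplicity {n} = foldr increment (increment (fromℕ n) (λ _ → 0ℤ))

sum-multiplicity : (w : Fin (suc n) → ℕ) → ∀ ks → sum (λ i → + w i ℤ.* multiplicity ks i) ≡ + total w ks
sum-multiplicity {n} w [] = trans (sum-increment (+_ ∘ w) (fromℕ n) (λ _ → 0ℤ))
  (trans (cong (ℤ._+_ (+ w (fromℕ n))) (sum-zero (+_ ∘ w))) (ℤ.+-identityʳ _))
sum-multiplicity w (k ∷ ks) = trans (sum-increment (+_ ∘ w) k (multiplicity ks))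
  (cong (ℤ._+_ (+ w k)) (sum-multiplicity w ks))

-- Yields both kinds of lower bounds in `Feasible`: the point of the empty list is nonnegative and
-- equals 1 at the last coordinate.
multiplicity-≥ : ∀ ks i → multiplicity {n} [] i ℤ.≤ multiplicity ks i
multiplicity-≥ []       i = ℤ.≤-refl
multiplicity-≥ (k ∷ ks) i = ℤ.≤-trans (multiplicity-≥ ks i) (increment-≥ k (multiplicity ks) i)

index≡⇒last : (i : Fin (suc n)) → index i ≡ suc n → i ≡ fromℕ n
index≡⇒last i eq = toℕ-injective (trans (ℕ.suc-injective eq) (sym (toℕ-fromℕ _)))

multiplicity-feasible : ∀ ks → total index ks ≡ N → Feasible N (multiplicity {n} ks)
multiplicity-feasible {n = n} ks eq =
    trans (sum-multiplicity index ks) (cong +_ eq)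
  , (λ i _ → ℤ.≤-trans (increment-≥ (fromℕ n) (λ _ → 0ℤ) i) (multiplicity-≥ ks i))
  , (λ i i-last → subst (λ j → 1ℤ ℤ.≤ multiplicity ks j) (sym (index≡⇒last i i-last))
      (subst (ℤ._≤ multiplicity ks (fromℕ n)) (updateAt-updates (fromℕ n) (λ _ → 0ℤ))
        (multiplicity-≥ ks (fromℕ n))))

total-replicate : (w : Fin (suc n) → ℕ) (m : ℕ) (k : Fin (suc n)) (ks : List (Fin (suc n))) →
  total w (replicate m k ++ ks) ≡ w k * m + total w ks
total-replicate w zero    k ks = cong (_+ total w ks) (sym (ℕ.*-zeroʳ (w k)))
total-replicate w (suc m) k ks = trans (cong (λ c → w k + c) (total-replicate w m k ks))
  (trans (sym (ℕ.+-assoc (w k) _ _)) (cong (_+ total w ks) (sym (ℕ.*-suc (w k) m))))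

-- The list with `y i` entries `h i` when `y` is nonnegative. The map `h` lets the recursion shrink
-- the index range while the entries keep their type.
expand : ∀ {m} → (Fin m → Fin n) → (Fin m → ℤ) → List (Fin n)
expand {m = zero}  h y = []
expand {m = suc m} h y = replicate ℤ.∣ y zero ∣ (h zero) ++ expand (h ∘ suc) (y ∘ suc)

-- The last summand is the value of `total` on the empty list.
total-expand : (w : Fin (suc n) → ℕ) → ∀ {m} (h : Fin m → Fin (suc n)) y → (∀ i → 0ℤ ℤ.≤ y i) →
  + total w (expand h y) ≡ sum (λ i → + w (h i) ℤ.* y i) ℤ.+ + w (fromℕ n)
total-expand w {zero}  h y y≥0 = sym (ℤ.+-identityˡ _)
total-expand {n} w {suc m} h y y≥0 = begin
  + total w (expand h y)                ≡⟨ cong +_ (total-replicate w ℤ.∣ y zero ∣ (h zero) ks) ⟩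
  + (w (h zero) * ℤ.∣ y zero ∣) ℤ.+ + total w ks
    ≡⟨ cong₂ ℤ._+_ (ℤ.pos-* (w (h zero)) ℤ.∣ y zero ∣) (total-expand w (h ∘ suc) (y ∘ suc) (y≥0 ∘ suc)) ⟩
  + w (h zero) ℤ.* + ℤ.∣ y zero ∣ ℤ.+ (s ℤ.+ wₙ)
    ≡⟨ cong (λ z → + w (h zero) ℤ.* z ℤ.+ (s ℤ.+ wₙ)) (ℤ.0≤i⇒+∣i∣≡i (y≥0 zero)) ⟩
  + w (h zero) ℤ.* y zero ℤ.+ (s ℤ.+ wₙ) ≡⟨ ℤ.+-assoc (+ w (h zero) ℤ.* y zero) s wₙ ⟨
  + w (h zero) ℤ.* y zero ℤ.+ s ℤ.+ wₙ  ∎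
  where
  open ≡-Reasoning
  ks = expand (h ∘ suc) (y ∘ suc)
  s  = sum (λ i → + w (h (suc i)) ℤ.* y (suc i))
  wₙ = + w (fromℕ n)

-- Lowering the last coordinate by one keeps it nonnegative, since it is at least 1; `total` then
-- restores the removed unit. One list serves all weights, hence both the size constraint and the
-- objective.
feasible⇒total : ∀ {x : Fin (suc n) → ℤ} → Feasible N x →
  ∃[ ks ] (total index ks ≡ N × (∀ (w : Fin (suc n) → ℕ) → sum (λ i → + w i ℤ.* x i) ≡ + total w ks))
feasible⇒total {n} {N} {x} (size , x≥0 , x-last≥1) =
  ks , ℤ.+-injective (trans (sym (sum-x index)) size) , sum-x
  where
  y : Fin (suc n) → ℤ
  y = updateAt x (fromℕ n) ℤ.pred

  y≥0 : ∀ i → 0ℤ ℤ.≤ y i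
  y≥0 i with i ≟ fromℕ n
  ... | yes refl = subst (0ℤ ℤ.≤_) (sym (updateAt-updates (fromℕ n) x))
    (ℤ.pred-mono (x-last≥1 i (index-last n)))
  ... | no i≢last = subst (0ℤ ℤ.≤_) (sym (updateAt-minimal i (fromℕ n) x i≢last))
    (x≥0 i (ℕ.≤∧≢⇒< (toℕ<n i) (i≢last ∘ index≡⇒last i)))

  ks : List (Fin (suc n))
  ks = expand id y

  sum-x : ∀ w → sum (λ i → + w i ℤ.* x i) ≡ + total w ks
  sum-x w = sym (begin
    + total w ks               ≡⟨ total-expand w id y y≥0 ⟩
    sum (λ i → + w i ℤ.* y i) ℤ.+ wₙ
      ≡⟨ cong (ℤ._+ wₙ) (sum-updateAt (+_ ∘ w) x (fromℕ n) -1ℤ) ⟩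
    wₙ ℤ.* -1ℤ ℤ.+ s ℤ.+ wₙ
      ≡⟨ cong (λ z → z ℤ.+ s ℤ.+ wₙ) (trans (ℤ.*-comm wₙ -1ℤ) (ℤ.-1*i≡-i wₙ)) ⟩
    ℤ.- wₙ ℤ.+ s ℤ.+ wₙ        ≡⟨ cong (ℤ._+ wₙ) (ℤ.+-comm (ℤ.- wₙ) s) ⟩
    s ℤ.+ ℤ.- wₙ ℤ.+ wₙ        ≡⟨ ℤ.+-assoc s (ℤ.- wₙ) wₙ ⟩
    s ℤ.+ (ℤ.- wₙ ℤ.+ wₙ)      ≡⟨ cong (ℤ._+_ s) (ℤ.+-inverseˡ wₙ) ⟩
    s ℤ.+ 0ℤ                   ≡⟨ ℤ.+-identityʳ s ⟩
    s                          ∎)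
    where
    open ≡-Reasoning
    wₙ = + w (fromℕ n)
    s  = sum (λ i → + w i ℤ.* x i)

-- Existence of minima and comparison of the two problems.

-- Every index is at least 1. This bounds the length of lists of a given total and makes the search
-- for them finite.
length≤total : (ks : List (Fin (suc n))) → length ks ≤ total index ks
length≤total []       = z≤n
length≤total (k ∷ ks) = ℕ.+-mono-≤ (s≤s z≤n) (length≤total ks)

n≤total : (ks : List (Fin (suc n))) → suc n ≤ total index ks
n≤total {n} []       = ℕ.≤-reflexive (sym (index-last n))
n≤total     (k ∷ ks) = ℕ.m≤n⇒m≤o+n (index k) (n≤total ks)

anyList? : {P : List (Fin n) → Set} → Decidable P → ∀ b → (∀ ks → P ks → length ks ≤ b) → Dec (∃ P)
anyList? {P = P} P? b bounded = map′
  (λ { (_ , _ , v , p) → Vec.toList v , p })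
  (λ { (ks , p) → length ks , s≤s (bounded ks p) , Vec.fromList ks , subst P (sym (toList∘fromList ks)) p })
  (ℕ.anyUpTo? (λ l → anyVec? l (P? ∘ Vec.toList)) (suc b))

-- Strong induction: as long as a smaller element of `Q` exists, pass to it.
least : {Q : ℕ → Set} → Decidable Q → ∀ v → Q v → ∃[ m ] (Q m × (∀ u → Q u → m ≤ u))
least {Q} Q? = <-rec _ λ v rec q → search v rec q (ℕ.anyUpTo? Q? v)
  where
  search : ∀ v → (∀ {u} → u < v → Q u → ∃[ m ] (Q m × (∀ u → Q u → m ≤ u))) → Q v →
    Dec (∃ λ u → u < v × Q u) → ∃[ m ] (Q m × (∀ u → Q u → m ≤ u))
  search v rec q (yes (u , u<v , q′)) = rec u<v q′
  search v rec q (no none)            = v , q , λ u q′ → ℕ.≮⇒≥ λ u<v → none (u , u<v , q′)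

-- Each set has an element at or below any given element of the other, which forces equal minima
-- even if `P` has values outside `Q`.
Coinitial : (ℕ → Set) → (ℤ → Set) → Set
Coinitial Q P = (∀ z → P z → ∃[ v ] (Q v × + v ℤ.≤ z)) × (∀ v → Q v → ∃[ z ] (P z × z ℤ.≤ + v))

-- Some `z` in `P` is at most `m`; it is also at least `m`, being above an element of `Q`, so `m`
-- itself lies in `P`.
coinitial-minimum : ∀ {Q P m} → Coinitial Q P → Q m → (∀ v → Q v → m ≤ v) → IsMinimum P [ + m ]
coinitial-minimum {Q} {P} {m} (below , above) q m-least = attained , lower-bound
  where
  lower-bound : ∀ z → P z → + m ℤ.≤ z
  lower-bound z Pz with v , Qv , v≤z ← below z Pz = ℤ.≤-trans (ℤ.+≤+ (m-least v Qv)) v≤z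

  attained : P (+ m)
  attained with z , Pz , z≤m ← above m q = subst P (ℤ.≤-antisym z≤m (lower-bound z Pz)) Pz

coinitial-empty : ∀ {Q P} → Coinitial Q P → (∀ v → ¬ Q v) → IsMinimum P ⊤⁺
coinitial-empty (below , _) none z Pz = let (v , Qv , _) = below z Pz in none v Qv

-- These values mediate between the two problems: clique counts and objective values are both
-- coinitial with them.
Attains : (Fin (suc n) → ℕ) → ℕ → ℕ → Set
Attains c N v = ∃[ ks ] (total index ks ≡ N × total c ks ≡ v)

attains? : (c : Fin (suc n) → ℕ) (N : ℕ) → Decidable (Attains c N)
attains? c N v = anyList? (λ ks → (total index ks ℕ.≟ N) ×-dec (total c ks ℕ.≟ v)) N
  λ ks (eq , _) → subst (length ks ≤_) eq (length≤total ks)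

someAttained? : (c : Fin (suc n) → ℕ) (N : ℕ) → Dec (∃ (Attains c N))
someAttained? c N = map′ (λ (ks , size) → total c ks , ks , size , refl) (λ (_ , ks , size , _) → ks , size)
  (anyList? (λ ks → total index ks ℕ.≟ N) N λ ks size → subst (length ks ≤_) size (length≤total ks))

cov-coinitial : (H : Graph (suc n)) → Fin N →
  Coinitial (Attains (minCopiesMeeting (K (suc t)) H ∘ index) N)
            (λ z → ∃[ G ] (Covered {N = N} H G × + #copies (K (suc t)) G ≡ z))
cov-coinitial {t = t} H v₀ =
    (λ { _ (G , cov , refl) →
      let ks , size , ≤copies = covered⇒total (K (suc t)) H G (Covered⇒embeddings {H = H} {G} cov) v₀
      in _ , (ks , size , refl) , ℤ.+≤+ ≤copies })
  , (λ { _ (ks , refl , refl) → 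
      let G , cov , copies≤ = total⇒covered {t = t} H ks
      in _ , (G , cov , refl) , ℤ.+≤+ copies≤ })

program-coinitial : (c : Fin (suc n) → ℕ) →
  Coinitial (Attains c N) (λ z → ∃[ x ] (Feasible N x × sum (λ i → + c i ℤ.* x i) ≡ z))
program-coinitial c =
    (λ { _ (x , feasible , refl) →
      let ks , size , value = feasible⇒total feasible
      in _ , (ks , size , refl) , ℤ.≤-reflexive (sym (value c)) })
  , (λ { _ (ks , size , refl) →
      _ , (multiplicity ks , multiplicity-feasible ks size , refl) , ℤ.≤-reflexive (sum-multiplicity c ks) })

-- Deciding whether `Q` is empty chooses between +∞ and the least element of `Q`. In the second case
-- `n ≤ N`, so `N < n` is absurd.
common-minimum : ∀ {n Q P P′} → Coinitial Q P → Coinitial Q P′ →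
  Decidable Q → Dec (∃ Q) → (∀ {v} → Q v → n ≤ N) →
  ∃[ m ] (IsMinimum P m × IsMinimum P′ m × (N < n → m ≡ ⊤⁺))
common-minimum c c′ Q? (no none) n≤N =
    ⊤⁺ , coinitial-empty c (λ v q → none (v , q)) , coinitial-empty c′ (λ v q → none (v , q)) , λ _ → refl
common-minimum c c′ Q? (yes (v , q)) n≤N with m , q′ , m-least ← least Q? v q =
    [ + m ] , coinitial-minimum c q′ m-least , coinitial-minimum c′ q′ m-least
  , λ N<n → contradiction (n≤N q′) (ℕ.<⇒≱ N<n)

theorem1p4 : (N t : ℕ) .{{_ : NonZero N}} .{{_ : NonZero t}} →
    (n : ℕ) (H : Graph n) →
    ∃[ m ] (IsCov (K t) N H m × IsOptimalValue (K t) N H m × (N < n → m ≡ ⊤⁺))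
-- For `n = 0` both minima are +∞: a copy of the empty graph contains no vertex, so it cannot cover
-- `zero`, and the empty sum in `Feasible` is 0, not `suc N`.
theorem1p4 (suc N) (suc t) zero H =
    ⊤⁺
  , (λ { v (G , cov , _) → noVertex {G} (cov zero) })
  , (λ { v (x , (() , _) , _) })
  , λ _ → refl
  where
  noVertex : ∀ {G : Graph (suc N)} → ¬ (∃[ S ] (IsCopy H G S × zero ∈ vertices S))
  noVertex (S , (_ , φ , _ , _ , φ-onto , _) , v∈) with () , _ ← φ-onto zero v∈
theorem1p4 (suc N) (suc t) (suc n) H =
  common-minimum (cov-coinitial H zero) (program-coinitial weight)
    (attains? weight (suc N)) (someAttained? weight (suc N))
    (λ (ks , size , _) → subst (suc n ≤_) size (n≤total ks))
  where
  weight : Fin (suc n) → ℕ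
  weight = minCopiesMeeting (K (suc t)) H ∘ index
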